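{- Let $n \ge 1$ and $\ell \ge 2$ be integers, and let $x^0=(x^0_1,\dots,x^0_n)\in\mathbb{Z}^n$ satisfy $x^0_1\le\dots\le x^0_n$ and have at least one entry that is a multiple of $\ell$. Let $S=(x^0\to x^1\to\dots\to x^j\to\dots)$ be the GM-sequence starting at $x^0$, and for $i\in[n]$ let $W_i$ be the associated infinite word in the alphabet $\{s,r\}$. If $\mathrm{range}(x^0)\le \ell$, then the following statements hold: (1) For every $i\in[n]$ and $j\ge 0$ we have $x_i^j-x_i^{j+n\ell}=(n-1)\ell$. (2) All infinite words $W_i$, $i\in[n]$, are equivalent and periodic; their common period $P$ is of length $p=n\ell$; the corresponding word $W(P)$ contains $\ell$ symbols $s$ and $(n-1)\ell$ symbols $r$. (3) For every $i\in[n]$, the length of a maximal sequence of successive $r$'s in $W_i$ is a multiple of $\ell$. (4) For every $i\in[n]$, the length of a maximal sequence of successive $s$'s in $W_i$ is at most $\ell$.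
   Context: Notation: $[n]=\{1,\dots,n\}$. Entries of vectors are integers and may be negative. For a vector with $x_1\le\dots\le x_n$, $\mathrm{range}(x)=x_n-x_1$. Pivot: let $x=(x_1,\dots,x_n)$ be an integer vector with $x_1\le \dots\le x_n$ having at least one entry that is a multiple of $\ell$. Choose a minimal entry of $x$ among those that are multiples of $\ell$; if there are several such entries, take the one with the largest index. This index $i\in[n]$ is the pivot of $x$, and $x_i$ is the pivotal entry. GM-move: the GM-move $x\to x'$ keeps the pivotal entry unchanged and reduces each of the remaining $n-1$ entries by $1$. The vector $x'$ again satisfies $x'_1\le\dots\le x'_n$ and has an entry that is a multiple of $\ell$. The GM-sequence starting at $x^0$ is the infinite sequence $x^0\to x^1\to x^2\to\dots$ of successive GM-moves. Words: for $i\in[n]$ and $j\ge 0$, put $l(i,j)=s$ if $i$ is the pivot of $x^j$, and $l(i,j)=r$ otherwise. The word $W_i$ is the infinite word $l(i,0)\,l(i,1)\,l(i,2)\cdots$. The word $W_i$ is called periodic if there is an integer $p>0$ such that $l(i,j)=l(i,j+p)$ for all $j\ge 0$; by default $p$ is assumed to be minimal. Any interval $P$ of $p$ successive symbols is called a period, and $p=|P|$ is its length; $W(P)$ denotes the word formed by the symbols of $P$. Two periodic words $W_i$ and $W_{i'}$ are called equivalent if their periods $P_i$ and $P_{i'}$ can be chosen equal.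
   Formalization: In (2) the length nℓ is a period, not necessarily the minimal one; in (3) runs of r's cut off by the start of W_i are excluded; in (4) only finite runs of s's are meant (for n=1 the word is all s). -}

module Defs where

open import Data.Bool.Base using (if_then_else_)
open import Data.Fin.Base as Fin using (Fin; zero; fromℕ; toℕ)
import Data.Fin.Properties as Fin
open import Data.Integer.Base using (ℤ; +_; 1ℤ; _-_; _≤_)
import Data.Integer.Properties as ℤ
open import Data.Integer.Divisibility.Signed using (_∣_; _∣?_)
open import Data.Nat.Base as ℕ using (ℕ; zero; suc; NonZero)
open import Data.Product.Base using (_×_; ∃)
open import Data.Vec.Base using (Vec; tabulate)
open import Data.Vec.Functional using (Vector)
open import Relation.Binary.Definitions using (DecidableEquality)
open import Relation.Binary.PropositionalEquality.Core using (_≡_; _≢_; refl)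
open import Relation.Nullary.Decidable.Core using (Dec; yes; no; does; _×-dec_; _→-dec_)

Sorted : ∀ {n} → Vector ℤ n → Set
Sorted x = ∀ i k → i Fin.≤ k → x i ≤ x k

range : ∀ {n} .{{_ : NonZero n}} → Vector ℤ n → ℤ
range {suc n} x = x (fromℕ n) - x zero

HasMultiple : ∀ {n} → ℕ → Vector ℤ n → Set
HasMultiple ℓ x = ∃ λ i → + ℓ ∣ x i

IsPivot : ∀ {n} → ℕ → Vector ℤ n → Fin n → Set
IsPivot ℓ x i =
  + ℓ ∣ x i
  × (∀ k → + ℓ ∣ x k → x i ≤ x k)
  × (∀ k → + ℓ ∣ x k → x k ≡ x i → k Fin.≤ i)

isPivot? : ∀ {n} ℓ (x : Vector ℤ n) i → Dec (IsPivot ℓ x i)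
isPivot? ℓ x i =
  (+ ℓ ∣? x i)
  ×-dec Fin.all? (λ k → (+ ℓ ∣? x k) →-dec (x i ℤ.≤? x k))
  ×-dec Fin.all? (λ k → (+ ℓ ∣? x k) →-dec ((x k ℤ.≟ x i) →-dec (k Fin.≤? i)))

-- A vector satisfying HasMultiple has exactly one pivot.  A vector without
-- a multiple of ℓ has none; the value of gmMove is then irrelevant.
gmMove : ∀ {n} → ℕ → Vector ℤ n → Vector ℤ n
gmMove ℓ x i = if does (isPivot? ℓ x i) then x i else x i - 1ℤ

gmSeq : ∀ {n} → ℕ → Vector ℤ n → ℕ → Vector ℤ n
gmSeq ℓ x zero    = x
gmSeq ℓ x (suc j) = gmMove ℓ (gmSeq ℓ x j)

data Symbol : Set where
  s r : Symbol

_≟_ : DecidableEquality Symbol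
s ≟ s = yes refl
s ≟ r = no λ ()
r ≟ s = no λ ()
r ≟ r = yes refl

Word : Set
Word = ℕ → Symbol

word : ∀ {n} → ℕ → Vector ℤ n → Fin n → Word
word ℓ x i j = if does (isPivot? ℓ (gmSeq ℓ x j) i) then s else r

window : Word → ℕ → ∀ p → Vec Symbol p
window w a p = tabulate λ (k : Fin p) → w (a ℕ.+ toℕ k)

-- Not necessarily minimal: for ℓ = 2 the word of the first entry of (0,1,2) is
-- srrsrr…, which has the period nℓ = 6 but minimal period 3.
HasPeriod : Word → ℕ → Set
HasPeriod w p = 0 ℕ.< p × (∀ j → w j ≡ w (j ℕ.+ p))

HasMinimalPeriod : Word → ℕ → Set
HasMinimalPeriod w p = HasPeriod w p × (∀ q → HasPeriod w q → p ℕ.≤ q)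

Periodic : Word → Set
Periodic w = ∃ λ p → HasPeriod w p

Equivalent : Word → Word → Set
Equivalent w w′ = ∃ λ p →
  HasMinimalPeriod w p × HasMinimalPeriod w′ p
  × (∃ λ a → ∃ λ b → window w a p ≡ window w′ b p)

-- The m symbols of w from position a on form a finite, nonempty block of c's
-- that cannot be extended on either side; nothing precedes position 0.
-- A run at position 0 of a periodic word may be the tail of a longer cyclic
-- run, so statements about exact run lengths should require a positive a.
record MaximalRun (c : Symbol) (w : Word) (a m : ℕ) : Set where
  field
    nonempty : 0 ℕ.< m
    constant : ∀ k → k ℕ.< m → w (a ℕ.+ k) ≡ c
    left     : ∀ b → a ≡ suc b → w b ≢ c
    right    : w (a ℕ.+ m) ≢ c

{-# OPTIONS --safe #-}

-- Adding j to the entries of xʲ makes a GM-move push one entry up by 1, namely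
-- the one sitting at the hand of a clock that advances by 1 per move.  Index
-- the entries by ℕ through z (k + n) = z k + ℓ; then the range condition says
-- that this extension of x⁰ is sorted, and the pivot is the last k with z k at
-- the hand.  When a pushed entry meets resting ones, the last of these takes
-- its role, so resting places are refilled and the index I j of the pushed
-- entry is the initial one plus the number of resting places passed so far.
-- Hence I is monotone and I (j + ℓ) = I j + (n - 1): after ℓ moves the pivot
-- index goes back by 1 modulo n.  All four claims follow from this.
module Submission where

open import Defs
open import Algebra.Properties.CommutativeSemigroup using (x∙yz≈y∙xz; x∙yz≈y∙zx)
open import Data.Bool.Base using (true; false; if_then_else_)
open import Data.Fin.Base as Fin using (Fin; zero; suc; toℕ; fromℕ; fromℕ<)
import Data.Fin.Properties as Fin
open import Data.Integer.Base as ℤ using (ℤ; +_; 0ℤ; 1ℤ; -_; _-_; +≤+; +<+; ∣_∣)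
import Data.Integer.Divisibility.Signed as ℤ∣
import Data.Integer.Properties as ℤ
open import Data.Integer.Tactic.RingSolver using (solve-∀)
open import Data.Nat.Base
  using (ℕ; zero; suc; _+_; _*_; _∸_; _≤_; _<_; _≤′_; NonZero; >-nonZero; z≤n; s≤s; ≤′-refl; ≤′-step)
open import Data.Nat.Divisibility using (_∣_; n∣m*n; ∣-refl; ∣⇒≤)
open import Data.Nat.DivMod
open import Data.Nat.Properties renaming (_≟_ to _≟ℕ_)
open import Data.Product.Base using (_×_; _,_; ∃; proj₁; proj₂)
open import Data.Sum.Base using (_⊎_; inj₁; inj₂)
open import Data.Vec.Base using (Vec; []; _∷_; count)
open import Data.Vec.Functional using (Vector)
open import Data.Vec.Properties using (tabulate-cong)
open import Function.Base using (_∘_)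
open import Relation.Binary.Definitions using (tri<; tri≈; tri>)
open import Relation.Binary.PropositionalEquality hiding (J)
open import Relation.Nullary.Decidable.Core using (Dec; yes; no; does; map′; _×-dec_)
open import Relation.Nullary.Negation using (¬_; contradiction)
open import Relation.Unary using (Decidable)

-- Best elements of finite sets.

-- Serves twice: for the pivot among the multiples of `ℓ`, and for the least period of a word.
∃-best : ∀ {n} {P : Fin n → Set} → Decidable P →
  (R : Fin n → Fin n → Set) → (∀ i → R i i) →
  (∀ {i j k} → R i j → R j k → R i k) → (∀ i j → R i j ⊎ R j i) →
  ∃ P → ∃ λ i → P i × ∀ k → P k → R i k
∃-best {suc n} P? R rfl tr total (k , pk) with Fin.any? (P? ∘ suc) | P? zero
... | no ∄ | no ¬p₀ with k
...   | zero = contradiction pk ¬p₀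
...   | suc k = contradiction (k , pk) ∄
∃-best {suc n} P? R rfl tr total _ | no ∄ | yes p₀ =
  zero , p₀ , λ { zero _ → rfl zero ; (suc k) pk → contradiction (k , pk) ∄ }
∃-best {suc n} P? R rfl tr total _ | yes ∃P | p₀?
  with ∃-best (P? ∘ suc) (λ i j → R (suc i) (suc j)) (rfl ∘ suc) tr (λ i j → total (suc i) (suc j)) ∃P
...   | b , pb , R-b with p₀? | total zero (suc b)
...     | no ¬p₀ | _ = suc b , pb , λ { zero p₀ → contradiction p₀ ¬p₀ ; (suc k) → R-b k }
...     | yes _ | inj₂ b≤0 = suc b , pb , λ { zero _ → b≤0 ; (suc k) → R-b k }
...     | yes p₀ | inj₁ 0≤b = zero , p₀ , λ { zero _ → rfl zero ; (suc k) pk → tr 0≤b (R-b k pk) }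

-- Residues and quotients modulo `n`.

module _ {n : ℕ} .{{_ : NonZero n}} where

  toℕ-mod : ∀ k → toℕ (k mod n) ≡ k % n
  toℕ-mod k = Fin.toℕ-fromℕ< (m%n<n k n)

  mod-cong : ∀ k m → k % n ≡ m % n → k mod n ≡ m mod n
  mod-cong k m eq = Fin.toℕ-injective (trans (toℕ-mod k) (trans eq (sym (toℕ-mod m))))

  mod-inverse : ∀ k m → k mod n ≡ m mod n → k % n ≡ m % n
  mod-inverse k m eq = trans (sym (toℕ-mod k)) (trans (cong toℕ eq) (toℕ-mod m))

  +-%-congˡ : ∀ c {a b} → a % n ≡ b % n → (c + a) % n ≡ (c + b) % n
  +-%-congˡ c {a} {b} eq = begin
    (c + a) % n           ≡⟨ %-distribˡ-+ c a n ⟩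
    (c % n + a % n) % n   ≡⟨ cong (λ z → (c % n + z) % n) eq ⟩
    (c % n + b % n) % n   ≡⟨ %-distribˡ-+ c b n ⟨
    (c + b) % n           ∎
    where open ≡-Reasoning

  %-injective-window : ∀ {a k} → a ≤ k → k < a + n → k % n ≡ a % n → k ≡ a
  %-injective-window {a} {k} a≤k k<a+n eq with k / n ≤? a / n
  ... | yes q≤ = begin
    k                  ≡⟨ m≡m%n+[m/n]*n k n ⟩
    k % n + k / n * n  ≡⟨ cong₂ (λ u v → u + v * n) eq (≤-antisym q≤ (/-monoˡ-≤ n a≤k)) ⟩
    a % n + a / n * n  ≡⟨ m≡m%n+[m/n]*n a n ⟨
    a                  ∎
    where open ≡-Reasoning
  ... | no q≰ = contradiction k<a+n (≤⇒≯ (begin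
    a + n                    ≡⟨ cong (_+ n) (m≡m%n+[m/n]*n a n) ⟩
    a % n + a / n * n + n    ≡⟨ +-assoc (a % n) _ n ⟩
    a % n + (a / n * n + n)  ≡⟨ cong (λ z → a % n + z) (+-comm _ n) ⟩
    a % n + suc (a / n) * n  ≤⟨ +-monoʳ-≤ (a % n) (*-monoˡ-≤ n (≰⇒> q≰)) ⟩
    a % n + k / n * n        ≡⟨ cong (_+ k / n * n) eq ⟨
    k % n + k / n * n        ≡⟨ m≡m%n+[m/n]*n k n ⟨
    k                        ∎))
    where open ≤-Reasoning

  [i+q*n]/n≡q : ∀ (i : Fin n) q → (toℕ i + q * n) / n ≡ q
  [i+q*n]/n≡q i q = trans (+-distrib-/-∣ʳ (toℕ i) (n∣m*n q))
    (cong₂ _+_ (m<n⇒m/n≡0 (Fin.toℕ<n i)) (m*n/n≡m q n))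

  [i+q*n]%n≡i : ∀ (i : Fin n) q → (toℕ i + q * n) % n ≡ toℕ i
  [i+q*n]%n≡i i q = trans ([m+kn]%n≡m%n (toℕ i) q n) (m<n⇒m%n≡m (Fin.toℕ<n i))

  [i+q*n]mod-n≡i : ∀ (i : Fin n) q → (toℕ i + q * n) mod n ≡ i
  [i+q*n]mod-n≡i i q = Fin.toℕ-injective (trans (toℕ-mod (toℕ i + q * n)) ([i+q*n]%n≡i i q))

  toℕ-mod-n : ∀ (i : Fin n) → toℕ i mod n ≡ i
  toℕ-mod-n i = Fin.toℕ-injective (trans (toℕ-mod (toℕ i)) (m<n⇒m%n≡m (Fin.toℕ<n i)))

  [n+k]%n≡k%n : ∀ k → (n + k) % n ≡ k % n
  [n+k]%n≡k%n k = trans (cong (_% n) (+-comm n k)) ([m+n]%n≡m%n k n)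

  [n+k]/n≡1+k/n : ∀ k → (n + k) / n ≡ suc (k / n)
  [n+k]/n≡1+k/n k = trans (+-distrib-/-∣ˡ k ∣-refl) (cong (_+ k / n) (n/n≡1 n))

  -- Going up from `a`, an index `i` smaller than `a mod n` is met only in the next lap, where its
  -- unrolled value gains `ℓ`. The last component records the lap, which later decides ties between
  -- equal entries.
  representative : ∀ a (i : Fin n) → ∃ λ k → a ≤ k × k < a + n × k mod n ≡ i
    × (k / n ≡ a / n × a mod n Fin.≤ i ⊎ k / n ≡ suc (a / n) × i Fin.< a mod n)
  representative a i with a mod n Fin.≤? i
  ... | yes a%≤i = toℕ i + a / n * n
    , (begin
        a                   ≡⟨ m≡m%n+[m/n]*n a n ⟩
        a % n + a / n * n   ≡⟨ cong (_+ a / n * n) (toℕ-mod a) ⟨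
        toℕ (a mod n) + a / n * n   ≤⟨ +-monoˡ-≤ _ a%≤i ⟩
        toℕ i + a / n * n   ∎)
    , (begin-strict
        toℕ i + a / n * n  <⟨ +-monoˡ-< _ (Fin.toℕ<n i) ⟩
        n + a / n * n      ≤⟨ +-monoʳ-≤ n (m/n*n≤m a n) ⟩
        n + a              ≡⟨ +-comm n a ⟩
        a + n              ∎)
    , [i+q*n]mod-n≡i i (a / n)
    , inj₁ ([i+q*n]/n≡q i (a / n) , a%≤i)
    where open ≤-Reasoning
  ... | no a%≰i = toℕ i + suc (a / n) * n
    , (begin
        a                   ≡⟨ m≡m%n+[m/n]*n a n ⟩
        a % n + a / n * n   ≤⟨ +-monoˡ-≤ _ (m%n≤n a n) ⟩
        suc (a / n) * n     ≤⟨ m≤n+m _ (toℕ i) ⟩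
        toℕ i + suc (a / n) * n   ∎)
    , (begin-strict
        toℕ i + suc (a / n) * n  <⟨ +-monoˡ-< _ (≰⇒> a%≰i) ⟩
        toℕ (a mod n) + suc (a / n) * n  ≡⟨ cong (_+ suc (a / n) * n) (toℕ-mod a) ⟩
        a % n + (n + a / n * n)  ≡⟨ cong (λ z → a % n + z) (+-comm n _) ⟩
        a % n + (a / n * n + n)  ≡⟨ +-assoc (a % n) _ n ⟨
        a % n + a / n * n + n    ≡⟨ cong (_+ n) (m≡m%n+[m/n]*n a n) ⟨
        a + n              ∎)
    , [i+q*n]mod-n≡i i (suc (a / n))
    , inj₂ ([i+q*n]/n≡q i (suc (a / n)) , ≰⇒> a%≰i)
    where open ≤-Reasoning

-- Counting arrivals at a hand with period `ℓ`.

-- For 1 ≤ a d ≤ ℓ, the summand of d is the number of elements of a d + ℓ ℕ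
-- in the interval [1, u].
module _ (ℓ : ℕ) .{{_ : NonZero ℓ}} (a : ℕ → ℕ) where

  arrivals : ℕ → ℕ → ℕ
  arrivals zero    u = 0
  arrivals (suc d) u = (u + (ℓ ∸ a d)) / ℓ + arrivals d u

  arrivals-monoʳ : ∀ d {u v} → u ≤ v → arrivals d u ≤ arrivals d v
  arrivals-monoʳ zero    u≤v = z≤n
  arrivals-monoʳ (suc d) u≤v =
    +-mono-≤ (/-monoˡ-≤ ℓ (+-monoˡ-≤ _ u≤v)) (arrivals-monoʳ d u≤v)

  arrivals-monoˡ : ∀ {d e} u → d ≤′ e → arrivals d u ≤ arrivals e u
  arrivals-monoˡ u ≤′-refl = ≤-refl
  arrivals-monoˡ u (≤′-step d≤e) = m≤n⇒m≤o+n _ (arrivals-monoˡ u d≤e)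

  -- A lap of length `ℓ` raises each of the `d` quotients by exactly one.
  arrivals-turn : ∀ d u → arrivals d (ℓ + u) ≡ d + arrivals d u
  arrivals-turn zero    u = refl
  arrivals-turn (suc d) u = begin
    (ℓ + u + c) / ℓ + arrivals d (ℓ + u)          ≡⟨ cong (λ z → z / ℓ + arrivals d (ℓ + u)) (+-assoc ℓ u c) ⟩
    (ℓ + (u + c)) / ℓ + arrivals d (ℓ + u)        ≡⟨ cong₂ _+_ ([n+k]/n≡1+k/n (u + c)) (arrivals-turn d u) ⟩
    suc ((u + c) / ℓ + (d + arrivals d u))        ≡⟨ cong suc (+-assoc ((u + c) / ℓ) d _) ⟨
    suc ((u + c) / ℓ + d + arrivals d u)          ≡⟨ cong (λ z → suc (z + arrivals d u)) (+-comm ((u + c) / ℓ) d) ⟩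
    suc (d + (u + c) / ℓ + arrivals d u)          ≡⟨ cong suc (+-assoc d _ _) ⟩
    suc (d + ((u + c) / ℓ + arrivals d u))        ∎
    where open ≡-Reasoning
          c = ℓ ∸ a d

  module _ {N : ℕ} (mono : ∀ {d e} → d ≤ e → e < N → a d ≤ a e)
    (positive : ∀ {d} → d < N → 0 < a d) (bounded : ∀ {d} → d < N → a d ≤ ℓ) where

    private
      arrived : ∀ {d u} → d < N → a d ≤ u → 0 < (u + (ℓ ∸ a d)) / ℓ
      arrived {d} {u} d<N ad≤u = m≥n⇒m/n>0 (begin
        ℓ                ≡⟨ m+[n∸m]≡n (bounded d<N) ⟨
        a d + (ℓ ∸ a d)  ≤⟨ +-monoˡ-≤ _ ad≤u ⟩
        u + (ℓ ∸ a d)    ∎)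
        where open ≤-Reasoning

      pending : ∀ {d u} → d < N → u < a d → (u + (ℓ ∸ a d)) / ℓ ≡ 0
      pending {d} {u} d<N u<ad = m<n⇒m/n≡0 (begin-strict
        u + (ℓ ∸ a d)    <⟨ +-monoˡ-< _ u<ad ⟩
        a d + (ℓ ∸ a d)  ≡⟨ m+[n∸m]≡n (bounded d<N) ⟩
        ℓ                ∎)
        where open ≤-Reasoning

      arrived-≤1 : ∀ {d u} → d < N → u < ℓ → (u + (ℓ ∸ a d)) / ℓ ≤ 1
      arrived-≤1 {d} {u} d<N u<ℓ = ≤-pred (m<n*o⇒m/o<n (begin-strict
        u + (ℓ ∸ a d)  <⟨ +-monoˡ-< _ u<ℓ ⟩
        ℓ + (ℓ ∸ a d)  ≤⟨ +-monoʳ-≤ ℓ (m∸n≤m ℓ (a d)) ⟩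
        ℓ + ℓ          ≡⟨ cong (λ z → ℓ + z) (+-identityʳ ℓ) ⟨
        2 * ℓ          ∎))
        where open ≤-Reasoning

      all-arrived : ∀ {e u} → e ≤ N → (∀ {d} → d < e → a d ≤ u) → e ≤ arrivals e u
      all-arrived {zero}  e≤N h = z≤n
      all-arrived {suc e} e≤N h =
        +-mono-≤ (arrived e≤N (h ≤-refl)) (all-arrived (<⇒≤ e≤N) (h ∘ m≤n⇒m≤1+n))

      -- Since `u < a d ≤ ℓ`, every progression contributes at most one, and those from `d` on
      -- contribute nothing because `a` is monotone.
      arrivals-≤ : ∀ {d u} → d < N → u < a d → ∀ {e} → e ≤ N → arrivals e u ≤ d
      arrivals-≤ d<N u<ad {zero} _ = z≤n
      arrivals-≤ {d} {u} d<N u<ad {suc e} e<N with d ≤? e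
      ... | yes d≤e = subst (λ z → z + arrivals e u ≤ d)
            (sym (pending e<N (<-≤-trans u<ad (mono d≤e e<N))))
            (arrivals-≤ d<N u<ad (<⇒≤ e<N))
      ... | no d≰e = ≤-trans
            (+-mono-≤ (arrived-≤1 e<N (<-≤-trans u<ad (bounded d<N))) (below e (<⇒≤ e<N)))
            (≰⇒> d≰e)
        where
        below : ∀ e → e ≤ N → arrivals e u ≤ e
        below zero    _   = z≤n
        below (suc e) e<N = +-mono-≤ (arrived-≤1 e<N (<-≤-trans u<ad (bounded d<N))) (below e (<⇒≤ e<N))

    arrivals-0 : ∀ {e} → e ≤ N → arrivals e 0 ≡ 0
    arrivals-0 {zero}  _   = refl
    arrivals-0 {suc e} e<N = cong₂ _+_ (pending e<N (positive e<N)) (arrivals-0 (<⇒≤ e<N))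

    -- By monotonicity of `a`, the first `suc d` progressions have all arrived by time `u`. Together
    -- with the converse below, this supplies the Galois connection at time 0.
    arrivals-galois⇒ : ∀ {d u} → d < N → a d ≤ u → d < arrivals N u
    arrivals-galois⇒ d<N ad≤u = ≤-trans
      (all-arrived d<N λ { (s≤s e≤d) → ≤-trans (mono e≤d d<N) ad≤u })
      (arrivals-monoˡ _ (≤⇒≤′ d<N))

    arrivals-galois⇐ : ∀ {d u} → d < N → d < arrivals N u → a d ≤ u
    arrivals-galois⇐ {d} {u} d<N d<A with a d ≤? u
    ... | yes ad≤u = ad≤u
    ... | no ad≰u = contradiction d<A (≤⇒≯ (arrivals-≤ d<N (≰⇒> ad≰u) ≤-refl))

-- Existence and uniqueness of the pivot.

if-yes : ∀ {A P : Set} (P? : Dec P) {a b : A} → P → (if does P? then a else b) ≡ a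
if-yes (yes _) p = refl
if-yes (no ¬p) p = contradiction p ¬p

if-no : ∀ {A P : Set} (P? : Dec P) {a b : A} → ¬ P → (if does P? then a else b) ≡ b
if-no (yes p) ¬p = contradiction p ¬p
if-no (no _)  ¬p = refl

IsPivot-unique : ∀ {n ℓ} {x : Vector ℤ n} {i k} → IsPivot ℓ x i → IsPivot ℓ x k → i ≡ k
IsPivot-unique (ℓ∣xi , min-i , max-i) (ℓ∣xk , min-k , max-k) =
  Fin.≤-antisym (max-k _ ℓ∣xi xi≡xk) (max-i _ ℓ∣xk (sym xi≡xk))
  where xi≡xk = ℤ.≤-antisym (min-i _ ℓ∣xk) (min-k _ ℓ∣xi)

pivot-exists : ∀ {n ℓ} {x : Vector ℤ n} → HasMultiple ℓ x → ∃ (IsPivot ℓ x)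
pivot-exists {ℓ = ℓ} {x} multiple =
  let i , ℓ∣xi , i-best = ∃-best (λ k → + ℓ ℤ∣.∣? x k) _≼_ (λ i → ℤ.≤-refl , λ _ → ≤-refl) ≼-trans ≼-total multiple
  in i , ℓ∣xi , (λ k ℓ∣xk → proj₁ (i-best k ℓ∣xk)) , λ k ℓ∣xk → proj₂ (i-best k ℓ∣xk)
  where
  -- Lexicographic: smaller entries first and, among equal entries, larger indices first. The pivot
  -- is the best multiple of `ℓ` in this order.
  _≼_ : Fin _ → Fin _ → Set
  i ≼ k = x i ℤ.≤ x k × (x k ≡ x i → k Fin.≤ i)

  ≼-trans : ∀ {i k m} → i ≼ k → k ≼ m → i ≼ m
  ≼-trans (xi≤xk , k≤i) (xk≤xm , m≤k) = ℤ.≤-trans xi≤xk xk≤xm , λ xm≡xi →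
    let xk≡xi = ℤ.≤-antisym (ℤ.≤-trans xk≤xm (ℤ.≤-reflexive xm≡xi)) xi≤xk
    in ≤-trans (m≤k (trans xm≡xi (sym xk≡xi))) (k≤i xk≡xi)

  ≼-total : ∀ i k → i ≼ k ⊎ k ≼ i
  ≼-total i k with ℤ.<-cmp (x i) (x k) | Fin.≤-total i k
  ... | tri< a _ _ | _ = inj₁ (ℤ.<⇒≤ a , λ xk≡xi → contradiction (sym xk≡xi) (ℤ.<⇒≢ a))
  ... | tri> _ _ c | _ = inj₂ (ℤ.<⇒≤ c , λ xi≡xk → contradiction (sym xi≡xk) (ℤ.<⇒≢ c))
  ... | tri≈ _ b _ | inj₁ i≤k = inj₂ (ℤ.≤-reflexive (sym b) , λ _ → i≤k)
  ... | tri≈ _ b _ | inj₂ k≤i = inj₁ (ℤ.≤-reflexive b , λ _ → k≤i)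

-- The unrolled sequence and how it shows the pivot.

[i-j]+j≡i : ∀ i j → (i - j) ℤ.+ j ≡ i
[i-j]+j≡i = solve-∀

i≤j+1⇒i-1≤j : ∀ {i j} → i ℤ.≤ 1ℤ ℤ.+ j → i - 1ℤ ℤ.≤ j
i≤j+1⇒i-1≤j {i} {j} i≤1+j = ℤ.≤-trans (ℤ.+-monoˡ-≤ (- 1ℤ) i≤1+j) (ℤ.≤-reflexive (lem j))
  where lem : ∀ j → 1ℤ ℤ.+ j - 1ℤ ≡ j
        lem = solve-∀

i-1≤j⇒i≤j+1 : ∀ {i j} → i - 1ℤ ℤ.≤ j → i ℤ.≤ 1ℤ ℤ.+ j
i-1≤j⇒i≤j+1 {i} {j} i-1≤j = ℤ.≤-trans (ℤ.≤-reflexive (lem i)) (ℤ.+-monoʳ-≤ 1ℤ i-1≤j)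
  where lem : ∀ i → i ≡ 1ℤ ℤ.+ (i - 1ℤ)
        lem = solve-∀

-- β is the initial pivotal entry, so that the extended sequence vanishes at
-- the pivot.  It is taken without the shift by j: the hand is always at 0.
module _ {n : ℕ} .{{_ : NonZero n}} (ℓ : ℕ) (β : ℤ) where

  unroll : Vector ℤ n → ℕ → ℤ
  unroll x k = (x (k mod n) - β) ℤ.+ + (k / n * ℓ)

  unroll-+n : ∀ x k → unroll x (n + k) ≡ unroll x k ℤ.+ + ℓ
  unroll-+n x k = begin
    (x ((n + k) mod n) - β) ℤ.+ + ((n + k) / n * ℓ)
      ≡⟨ cong₂ (λ i q → (x i - β) ℤ.+ + (q * ℓ)) (mod-cong (n + k) k ([n+k]%n≡k%n k)) ([n+k]/n≡1+k/n k) ⟩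
    (x (k mod n) - β) ℤ.+ (+ ℓ ℤ.+ + (k / n * ℓ))
      ≡⟨ lem (x (k mod n) - β) (+ ℓ) (+ (k / n * ℓ)) ⟩
    unroll x k ℤ.+ + ℓ ∎
    where
    open ≡-Reasoning
    lem : ∀ a b c → a ℤ.+ (b ℤ.+ c) ≡ a ℤ.+ c ℤ.+ b
    lem = solve-∀

  unroll-decompose : ∀ x {i k q} → k mod n ≡ i → k / n ≡ q → x i ≡ unroll x k ℤ.+ (β - + (q * ℓ))
  unroll-decompose x {k = k} refl refl = lem (x (k mod n)) β (+ (k / n * ℓ))
    where lem : ∀ a b c → a ≡ ((a - b) ℤ.+ c) ℤ.+ (b - c)
          lem = solve-∀

  -- A competitor in the lap of `a` is strictly larger, its unrolled value being positive. One from
  -- the next lap has unrolled value `e` in (0, `ℓ`] and entry `e - ℓ` above the pivotal one;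
  -- divisibility forces `e = ℓ`, so it ties and loses by its smaller index.
  unroll⇒IsPivot : + ℓ ℤ∣.∣ β → ∀ {x a} → unroll x a ≡ 0ℤ →
    (∀ k → a < k → k < a + n → 0ℤ ℤ.< unroll x k × unroll x k ℤ.≤ + ℓ) →
    IsPivot ℓ x (a mod n)
  unroll⇒IsPivot ℓ∣β {x} {a} zero-a window =
    ℓ∣xa , (λ i → proj₁ ∘ others i) , (λ i → proj₂ ∘ others i)
    where
    c = β - + (a / n * ℓ)

    xa≡c : x (a mod n) ≡ c
    xa≡c = trans (unroll-decompose x {k = a} refl refl) (trans (cong (ℤ._+ c) zero-a) (ℤ.+-identityˡ c))

    ℓ∣c : + ℓ ℤ∣.∣ c
    ℓ∣c = ℤ∣.∣m∣n⇒∣m-n ℓ∣β (ℤ∣.∣ᵤ⇒∣ (n∣m*n (a / n)))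

    ℓ∣xa : + ℓ ℤ∣.∣ x (a mod n)
    ℓ∣xa = subst (+ ℓ ℤ∣.∣_) (sym xa≡c) ℓ∣c

    ℓ∣e⇒ℓ≤e : ∀ {e} → 0ℤ ℤ.< e → + ℓ ℤ∣.∣ e → + ℓ ℤ.≤ e
    ℓ∣e⇒ℓ≤e (+<+ 0<e) ℓ∣e = +≤+ (∣⇒≤ {{>-nonZero 0<e}} (ℤ∣.∣⇒∣ᵤ ℓ∣e))

    others : ∀ i → + ℓ ℤ∣.∣ x i → x (a mod n) ℤ.≤ x i × (x i ≡ x (a mod n) → i Fin.≤ a mod n)
    others i ℓ∣xi with representative a i
    ... | k , a≤k , k<a+n , k≡i , q with a ≟ℕ k
    ...   | yes refl rewrite k≡i = ℤ.≤-refl , λ _ → ≤-refl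
    ...   | no a≢k with window k (≤∧≢⇒< a≤k a≢k) k<a+n | q
    ...     | 0<e , e≤ℓ | inj₁ (k/n , _) = ℤ.<⇒≤ xa<xi , λ xi≡xa → contradiction (sym xi≡xa) (ℤ.<⇒≢ xa<xi)
      where
      xa<xi : x (a mod n) ℤ.< x i
      xa<xi = subst₂ ℤ._<_ (trans (ℤ.+-identityˡ c) (sym xa≡c)) (sym (unroll-decompose x {k = k} k≡i k/n)) (ℤ.+-monoˡ-< c 0<e)
    ...     | 0<e , e≤ℓ | inj₂ (k/n , i<a) = ℤ.≤-reflexive (sym xi≡xa) , λ _ → <⇒≤ i<a
      where
      e = unroll x k

      xi≡ : x i ≡ (e - + ℓ) ℤ.+ c
      xi≡ = trans (unroll-decompose x {k = k} k≡i k/n) (lem e β (+ ℓ) (+ (a / n * ℓ)))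
        where lem : ∀ e b l q → e ℤ.+ (b - (l ℤ.+ q)) ≡ (e - l) ℤ.+ (b - q)
              lem = solve-∀

      ℓ∣e : + ℓ ℤ∣.∣ e
      ℓ∣e = subst (+ ℓ ℤ∣.∣_) ([i-j]+j≡i e (+ ℓ)) (ℤ∣.∣m∣n⇒∣m+n {m = e - + ℓ}
        (ℤ∣.∣m+n∣n⇒∣m {m = e - + ℓ} (subst (+ ℓ ℤ∣.∣_) xi≡ ℓ∣xi) ℓ∣c) ℤ∣.∣-refl)

      xi≡xa : x i ≡ x (a mod n)
      xi≡xa = begin
        x i                  ≡⟨ xi≡ ⟩
        (e - + ℓ) ℤ.+ c      ≡⟨ cong (λ z → (z - + ℓ) ℤ.+ c) (ℤ.≤-antisym e≤ℓ (ℓ∣e⇒ℓ≤e 0<e ℓ∣e)) ⟩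
        (+ ℓ - + ℓ) ℤ.+ c    ≡⟨ cong (ℤ._+ c) (ℤ.+-inverseʳ (+ ℓ)) ⟩
        0ℤ ℤ.+ c             ≡⟨ ℤ.+-identityˡ c ⟩
        c                    ≡⟨ xa≡c ⟨
        x (a mod n)          ∎
        where open ≡-Reasoning

-- GM-moves preserve alignment with the hand.

-- Besides alignment at time 0, these two properties are all that the dynamics and the claims on
-- words use of the hand index. `N` stands for `n - 1`.
record IsHand (ℓ N : ℕ) (I : ℕ → ℕ) : Set where
  field
    mono : ∀ {u v} → u ≤ v → I u ≤ I v
    turn : ∀ u → I (ℓ + u) ≡ N + I u

module Dynamics {N ℓ : ℕ} {β : ℤ} (0<ℓ : 0 < ℓ) (ℓ∣β : + ℓ ℤ∣.∣ β) {I : ℕ → ℕ} (hand : IsHand ℓ N I) where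

  open IsHand hand

  private n = suc N

  -- The Galois connection says that the entries k ahead of the hand rest where
  -- the hand index reaches k: entry k is at distance ≤ u iff I (u + j) ≥ k.
  record Aligned (j : ℕ) (x : Vector ℤ n) : Set where
    field
      at-hand : unroll ℓ β x (I j) ≡ 0ℤ
      galois⇒ : ∀ {k u} → I j < k → k < I j + n → unroll ℓ β x k ℤ.≤ + u → k ≤ I (u + j)
      galois⇐ : ∀ {k u} → I j < k → k < I j + n → k ≤ I (u + j) → unroll ℓ β x k ℤ.≤ + u

    -- Positivity is `galois⇒` at `u = 0`, which would put `k` at or behind the hand. The upper
    -- bound is `galois⇐` at `u = ℓ`, as a full turn ends at `N + I j`, the last index of the
    -- window.
    ahead : ∀ k → I j < k → k < I j + n → 0ℤ ℤ.< unroll ℓ β x k × unroll ℓ β x k ℤ.≤ + ℓ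
    ahead k lo hi = ℤ.≰⇒> (λ e≤0 → ≤⇒≯ (galois⇒ {k} lo hi e≤0) lo)
      , galois⇐ {k} lo hi (≤-trans (≤-pred (subst (k <_) (+-suc (I j) N) hi))
          (≤-reflexive (trans (+-comm (I j) N) (sym (turn j)))))

    isPivot : IsPivot ℓ x (I j mod n)
    isPivot = unroll⇒IsPivot ℓ β ℓ∣β {x} {I j} at-hand ahead

  open Aligned

  -- One move is part of a turn, so the hand cannot pass a whole lap of `n` indices in it.
  next≤ : ∀ j → I (suc j) ≤ N + I j
  next≤ j = ≤-trans (mono (+-monoˡ-≤ j 0<ℓ)) (≤-reflexive (turn j))

  unroll-gmMove-hand : ∀ {j x} k → Aligned j x → k % n ≡ I j % n →
    unroll ℓ β (gmMove ℓ x) k ≡ unroll ℓ β x k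
  unroll-gmMove-hand {j} {x} k al eq = cong (λ z → (z - β) ℤ.+ + (k / n * ℓ))
    (if-yes (isPivot? ℓ x (k mod n)) (subst (IsPivot ℓ x) (mod-cong (I j) k (sym eq)) (isPivot al)))

  unroll-gmMove-other : ∀ {j x} k → Aligned j x → k % n ≢ I j % n →
    unroll ℓ β (gmMove ℓ x) k ≡ unroll ℓ β x k - 1ℤ
  unroll-gmMove-other {j} {x} k al neq = trans
    (cong (λ z → (z - β) ℤ.+ + (k / n * ℓ)) (if-no (isPivot? ℓ x (k mod n))
      λ piv → neq (mod-inverse k (I j) (IsPivot-unique {ℓ = ℓ} {x} piv (isPivot al)))))
    (lem (x (k mod n)) β (+ (k / n * ℓ)))
    where lem : ∀ a b c → (a - 1ℤ - b) ℤ.+ c ≡ (a - b) ℤ.+ c - 1ℤ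
          lem = solve-∀

  unroll-gmMove-ahead : ∀ {j x k} → Aligned j x → I j < k → k < I j + n →
    unroll ℓ β (gmMove ℓ x) k ≡ unroll ℓ β x k - 1ℤ
  unroll-gmMove-ahead {k = k} al lo hi =
    unroll-gmMove-other k al (>⇒≢ lo ∘ %-injective-window (<⇒≤ lo) hi)

  -- `galois⇐` at `u = 1` bounds the positive value by one. The move therefore brings all these
  -- entries to 0, and the last of them becomes the pushed one.
  unroll-reached : ∀ {j x k} → Aligned j x → I j < k → k < I j + n → k ≤ I (suc j) → unroll ℓ β x k ≡ 1ℤ
  unroll-reached al lo hi k≤I′ = ℤ.≤-antisym (galois⇐ al lo hi k≤I′) (ℤ.i<j⇒suc[i]≤j (proj₁ (ahead al _ lo hi)))

  -- For an entry that was ahead already, the move lowers its value by one, which matches trading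
  -- `u` at time `suc j` for `suc u` at time `j`. Only the entries just left behind need a separate
  -- argument.
  Aligned-gmMove : ∀ {j x} → Aligned j x → Aligned (suc j) (gmMove ℓ x)
  Aligned-gmMove {j} {x} al = record { at-hand = at-hand′ ; galois⇒ = galois⇒′ ; galois⇐ = galois⇐′ }
    where
    y = unroll ℓ β (gmMove ℓ x)

    I≤I′ : I j ≤ I (suc j)
    I≤I′ = mono (n≤1+n j)

    I+n≡ : I j + n ≡ suc (N + I j)
    I+n≡ = +-comm (I j) n

    I′<I+n : I (suc j) < I j + n
    I′<I+n = subst (I (suc j) <_) (sym I+n≡) (s≤s (next≤ j))

    at-hand′ : y (I (suc j)) ≡ 0ℤ
    at-hand′ with m≤n⇒m<n∨m≡n I≤I′
    ... | inj₂ eq = trans (unroll-gmMove-hand (I (suc j)) al (cong (_% n) (sym eq)))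
                          (trans (cong (unroll ℓ β x) (sym eq)) (at-hand al))
    ... | inj₁ lo = trans (unroll-gmMove-ahead al lo I′<I+n)
                          (cong (_- 1ℤ) (unroll-reached al lo I′<I+n ≤-refl))

    wrapped : ∀ m → I j ≤ m → n + m < I (suc j) + n → y (n + m) ≡ + ℓ
    wrapped m I≤m hi with m≤n⇒m<n∨m≡n I≤m
    ... | inj₂ refl = trans (unroll-+n ℓ β (gmMove ℓ x) (I j))
                     (cong (ℤ._+ + ℓ) (trans (unroll-gmMove-hand (I j) al refl) (at-hand al)))
    ... | inj₁ lo = trans (unroll-+n ℓ β (gmMove ℓ x) m) (cong (ℤ._+ + ℓ)
          (trans (unroll-gmMove-ahead al lo (<-trans m<I′ I′<I+n))
                 (cong (_- 1ℤ) (unroll-reached al lo (<-trans m<I′ I′<I+n) (<⇒≤ m<I′)))))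
      where
      m<I′ : m < I (suc j)
      m<I′ = +-cancelˡ-< n _ _ (subst (n + m <_) (+-comm (I (suc j)) n) hi)

    -- The entries that the hand has just left behind reappear ahead of it one
    -- lap later; all of them are now exactly ℓ away.
    data View (k : ℕ) : Set where
      near : k < I j + n → View k
      far  : ∀ m → I j ≤ m → n + m ≡ k → View k

    view : ∀ k → View k
    view k with k <? I j + n
    ... | yes k<I+n = near k<I+n
    ... | no k≮I+n = far (k ∸ n)
      (subst (_≤ k ∸ n) (m+n∸n≡m (I j) n) (∸-monoˡ-≤ n (≮⇒≥ k≮I+n)))
      (m+[n∸m]≡n (≤-trans (m≤n+m n (I j)) (≮⇒≥ k≮I+n)))

    galois⇒′ : ∀ {k u} → I (suc j) < k → k < I (suc j) + n → y k ℤ.≤ + u → k ≤ I (u + suc j)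
    galois⇒′ {k} {u} lo hi y≤u with view k
    ... | near k<I+n = subst (λ z → k ≤ I z) (sym (+-suc u j))
          (galois⇒ al (≤-<-trans I≤I′ lo) k<I+n
            (i-1≤j⇒i≤j+1 (subst (ℤ._≤ + u) (unroll-gmMove-ahead al (≤-<-trans I≤I′ lo) k<I+n) y≤u)))
    -- The value is `ℓ`, so the assumption gives `ℓ ≤ u`, and `ℓ` moves carry the hand to the end of
    -- the window.
    ... | far m I≤m refl = begin
          n + m            ≤⟨ ≤-pred (subst (n + m <_) (+-comm (I (suc j)) n) hi) ⟩
          N + I (suc j)    ≡⟨ turn (suc j) ⟨
          I (ℓ + suc j)    ≤⟨ mono (+-monoˡ-≤ (suc j) (ℤ.drop‿+≤+ (subst (ℤ._≤ + u) (wrapped m I≤m hi) y≤u))) ⟩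
          I (u + suc j)    ∎
          where open ≤-Reasoning

    galois⇐′ : ∀ {k u} → I (suc j) < k → k < I (suc j) + n → k ≤ I (u + suc j) → y k ℤ.≤ + u
    galois⇐′ {k} {u} lo hi k≤I with view k
    ... | near k<I+n = subst (ℤ._≤ + u) (sym (unroll-gmMove-ahead al (≤-<-trans I≤I′ lo) k<I+n))
          (i≤j+1⇒i-1≤j (galois⇐ al (≤-<-trans I≤I′ lo) k<I+n (subst (λ z → k ≤ I z) (+-suc u j) k≤I)))
    -- If `u < ℓ`, the hand has made at most one turn since time `j` and is at `N + I j` or before,
    -- short of `n + I j ≤ n + m`.
    ... | far m I≤m refl = subst (ℤ._≤ + u) (sym (wrapped m I≤m hi)) (+≤+ (≮⇒≥ λ u<ℓ → contradiction k≤I (<⇒≱ (begin-strict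
          I (u + suc j)  ≡⟨ cong I (+-suc u j) ⟩
          I (suc u + j)  ≤⟨ mono (+-monoˡ-≤ j u<ℓ) ⟩
          I (ℓ + j)      ≡⟨ turn j ⟩
          N + I j        <⟨ s≤s (+-monoʳ-≤ N I≤m) ⟩
          n + m          ∎))))
          where open ≤-Reasoning

  Aligned-gmSeq : ∀ {x} → Aligned 0 x → ∀ j → Aligned j (gmSeq ℓ x j)
  Aligned-gmSeq al zero    = al
  Aligned-gmSeq al (suc j) = Aligned-gmMove (Aligned-gmSeq al j)

-- The initial hand and its alignment.

module Start {N ℓ : ℕ} (0<ℓ : 0 < ℓ) {x : Vector ℤ (suc N)}
  (sorted : Sorted x) (narrow : range x ℤ.≤ + ℓ) {p : Fin (suc N)} (pivot : IsPivot ℓ x p) where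

  private
    n = suc N
    β = x p
    y = unroll ℓ β x

  ℓ∣β : + ℓ ℤ∣.∣ β
  ℓ∣β = proj₁ pivot

  -- The range condition enters here: it keeps the extension sorted where one lap passes into the
  -- next.
  spread : ∀ i k → x i ℤ.≤ x k ℤ.+ + ℓ
  spread i k = begin
    x i                                    ≤⟨ sorted i _ (Fin.≤fromℕ i) ⟩
    x (Fin.fromℕ N)                        ≡⟨ lem (x (Fin.fromℕ N)) (x zero) ⟩
    x zero ℤ.+ range x                     ≤⟨ ℤ.+-mono-≤ (sorted zero k z≤n) narrow ⟩
    x k ℤ.+ + ℓ                            ∎
    where
    open ℤ.≤-Reasoning
    lem : ∀ a b → a ≡ b ℤ.+ (a - b)
    lem = solve-∀

  data Lap : ℕ → Set where
    first  : ∀ (i : Fin n) → p Fin.< i → Lap (toℕ i)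
    second : ∀ (i : Fin n) → i Fin.< p → Lap (n + toℕ i)

  lap : ∀ {k} → toℕ p < k → k < toℕ p + n → Lap k
  lap {k} lo hi with k <? n
  ... | yes k<n = subst Lap k≡ (first (fromℕ< k<n) (subst (toℕ p <_) (sym k≡) lo))
    where k≡ = Fin.toℕ-fromℕ< k<n
  ... | no k≮n = subst Lap (trans (cong (λ z → n + z) k≡) (m+[n∸m]≡n n≤k))
                  (second (fromℕ< k<n) (subst (_< toℕ p) (sym k≡) k<p))
    where
    n≤k = ≮⇒≥ k≮n
    k<p : k ∸ n < toℕ p
    k<p = subst (k ∸ n <_) (m+n∸n≡m (toℕ p) n) (∸-monoˡ-< hi n≤k)
    k<n = <-trans k<p (Fin.toℕ<n p)
    k≡ = Fin.toℕ-fromℕ< k<n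

  unroll-first : ∀ i → y (toℕ i) ≡ x i - β
  unroll-first i = trans (cong₂ (λ i q → (x i - β) ℤ.+ + (q * ℓ)) (toℕ-mod-n i) (m<n⇒m/n≡0 (Fin.toℕ<n i)))
    (ℤ.+-identityʳ (x i - β))

  unroll-second : ∀ (i : Fin n) → y (n + toℕ i) ≡ (x i - β) ℤ.+ + ℓ
  unroll-second i = trans (unroll-+n ℓ β x (toℕ i)) (cong (ℤ._+ + ℓ) (unroll-first i))

  swap-ℓ : ∀ i → (x i ℤ.+ + ℓ) - β ≡ (x i - β) ℤ.+ + ℓ
  swap-ℓ i = lem (x i) (+ ℓ) β
    where lem : ∀ a b c → (a ℤ.+ b) - c ≡ (a - c) ℤ.+ b
          lem = solve-∀

  unroll-mono : ∀ {k m} → Lap k → Lap m → k ≤ m → y k ℤ.≤ y m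
  unroll-mono (first i _) (first j _) i≤j =
    subst₂ ℤ._≤_ (sym (unroll-first i)) (sym (unroll-first j)) (ℤ.+-monoˡ-≤ (- β) (sorted i j i≤j))
  unroll-mono (first i _) (second j _) _ =
    subst₂ ℤ._≤_ (sym (unroll-first i)) (sym (trans (unroll-second j) (sym (swap-ℓ j))))
      (ℤ.+-monoˡ-≤ (- β) (spread i j))
  unroll-mono (second i _) (first j _) n+i≤j =
    contradiction (Fin.toℕ<n j) (≤⇒≯ (≤-trans (m≤m+n n (toℕ i)) n+i≤j))
  unroll-mono (second i _) (second j _) i≤j =
    subst₂ ℤ._≤_ (sym (unroll-second i)) (sym (unroll-second j))
      (ℤ.+-monoˡ-≤ (+ ℓ) (ℤ.+-monoˡ-≤ (- β) (sorted i j (+-cancelˡ-≤ n _ _ i≤j))))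

  -- The value 0 is excluded by the choice of `p`: after `p` it would be an equal entry of larger
  -- index, and before `p` an entry `β - ℓ`, a smaller multiple of `ℓ`.
  unroll-bounds : ∀ {k} → Lap k → 0ℤ ℤ.< y k × y k ℤ.≤ + ℓ
  unroll-bounds (first i p<i) rewrite unroll-first i = positive , bounded
    where
    β≤xi = sorted p i (<⇒≤ p<i)
    positive : 0ℤ ℤ.< x i - β
    positive = ℤ.≤∧≢⇒< (ℤ.i≤j⇒0≤j-i β≤xi) λ 0≡ →
      let xi≡β = ℤ.i-j≡0⇒i≡j (x i) β (sym 0≡)
      in contradiction p<i (≤⇒≯ (proj₂ (proj₂ pivot) i (subst (+ ℓ ℤ∣.∣_) (sym xi≡β) ℓ∣β) xi≡β))
    bounded : x i - β ℤ.≤ + ℓ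
    bounded = ℤ.≤-trans (ℤ.+-monoˡ-≤ (- β) (spread i p)) (ℤ.≤-reflexive (lem β (+ ℓ)))
      where lem : ∀ b l → (b ℤ.+ l) - b ≡ l
            lem = solve-∀
  unroll-bounds (second i i<p) rewrite unroll-second i = positive , bounded
    where
    xi≤β = sorted i p (<⇒≤ i<p)
    positive : 0ℤ ℤ.< (x i - β) ℤ.+ + ℓ
    positive = subst (0ℤ ℤ.<_) (swap-ℓ i) (ℤ.≤∧≢⇒< (ℤ.i≤j⇒0≤j-i (spread p i)) λ 0≡ →
      let xi+ℓ≡β = ℤ.i-j≡0⇒i≡j (x i ℤ.+ + ℓ) β (sym 0≡)
          ℓ∣xi = ℤ∣.∣m+n∣n⇒∣m {m = x i} (subst (+ ℓ ℤ∣.∣_) (sym xi+ℓ≡β) ℓ∣β) ℤ∣.∣-refl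
          xi+ℓ≤xi = subst (ℤ._≤ x i) (sym xi+ℓ≡β) (proj₁ (proj₂ pivot) i ℓ∣xi)
          xi<xi+ℓ = subst (ℤ._< x i ℤ.+ + ℓ) (ℤ.+-identityʳ (x i)) (ℤ.+-monoʳ-< (x i) (+<+ 0<ℓ))
      in ℤ.<⇒≱ xi<xi+ℓ xi+ℓ≤xi)
    bounded : (x i - β) ℤ.+ + ℓ ℤ.≤ + ℓ
    bounded = ℤ.≤-trans (ℤ.+-monoˡ-≤ (+ ℓ) (ℤ.i≤j⇒i-j≤0 xi≤β)) (ℤ.≤-reflexive (ℤ.+-identityˡ (+ ℓ)))

  -- Counts from the entry right after the pivot, so `d < N` covers all others. The absolute value
  -- loses nothing there, the unrolled values being positive.
  delay : ℕ → ℕ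
  delay d = ∣ y (suc (d + toℕ p)) ∣

  private
    instance _ = >-nonZero 0<ℓ

    lapᵈ : ∀ {d} → d < N → Lap (suc (d + toℕ p))
    lapᵈ {d} d<N = lap (s≤s (m≤n+m (toℕ p) d))
      (subst (suc (d + toℕ p) <_) (+-comm n (toℕ p)) (s≤s (+-monoˡ-< (toℕ p) d<N)))

    +delay : ∀ {d} → d < N → + delay d ≡ y (suc (d + toℕ p))
    +delay d<N = ℤ.0≤i⇒+∣i∣≡i (ℤ.<⇒≤ (proj₁ (unroll-bounds (lapᵈ d<N))))

    delay-mono : ∀ {d e} → d ≤ e → e < N → delay d ≤ delay e
    delay-mono d≤e e<N = ℤ.drop‿+≤+ (subst₂ ℤ._≤_ (sym (+delay d<N)) (sym (+delay e<N))
      (unroll-mono (lapᵈ d<N) (lapᵈ e<N) (s≤s (+-monoˡ-≤ (toℕ p) d≤e))))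
      where d<N = ≤-<-trans d≤e e<N

    delay-positive : ∀ {d} → d < N → 0 < delay d
    delay-positive d<N = ℤ.drop‿+<+ (subst (0ℤ ℤ.<_) (sym (+delay d<N)) (proj₁ (unroll-bounds (lapᵈ d<N))))

    delay-bounded : ∀ {d} → d < N → delay d ≤ ℓ
    delay-bounded d<N = ℤ.drop‿+≤+ (subst (ℤ._≤ + ℓ) (sym (+delay d<N)) (proj₂ (unroll-bounds (lapᵈ d<N))))

  -- Each refilled resting place is passed once per turn, at the times `delay d`, `delay d + ℓ`, and
  -- so on.
  handAt : ℕ → ℕ
  handAt u = arrivals ℓ delay N u + toℕ p

  isHand : IsHand ℓ N handAt
  isHand = record
    { mono = λ u≤v → +-monoˡ-≤ (toℕ p) (arrivals-monoʳ ℓ delay N u≤v)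
    ; turn = λ u → trans (cong (_+ toℕ p) (arrivals-turn ℓ delay N u)) (+-assoc N _ (toℕ p))
    }

  open Dynamics 0<ℓ ℓ∣β isHand public

  private
    handAt-0 : handAt 0 ≡ toℕ p
    handAt-0 = cong (_+ toℕ p) (arrivals-0 ℓ delay {N} delay-mono delay-positive delay-bounded ≤-refl)

    offset : ∀ {k} → handAt 0 < k → k < handAt 0 + n → ∃ λ d → d < N × k ≡ suc (d + toℕ p)
    offset {k} lo hi = k ∸ suc (toℕ p)
      , subst (k ∸ suc (toℕ p) <_) (m+n∸n≡m N (suc (toℕ p)))
          (∸-monoˡ-< (subst (k <_) (trans (cong (_+ n) handAt-0) (trans (+-comm (toℕ p) n) (sym (+-suc N (toℕ p))))) hi) p<k)
      , trans (sym (m∸n+n≡m p<k)) (+-suc _ (toℕ p))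
      where p<k = subst (_< k) handAt-0 lo

  aligned-start : Aligned 0 x
  aligned-start = record
    { at-hand = trans (cong y handAt-0) (trans (unroll-first p) (ℤ.+-inverseʳ β))
    ; galois⇒ = start⇒
    ; galois⇐ = start⇐
    }
    where
    start⇒ : ∀ {k u} → handAt 0 < k → k < handAt 0 + n → y k ℤ.≤ + u → k ≤ handAt (u + 0)
    start⇒ {u = u} lo hi y≤u with offset lo hi
    ... | d , d<N , refl = +-monoˡ-< (toℕ p) (subst (λ z → d < arrivals ℓ delay N z) (sym (+-identityʳ u))
      (arrivals-galois⇒ ℓ delay delay-mono delay-positive delay-bounded d<N
        (ℤ.drop‿+≤+ (subst (ℤ._≤ + u) (sym (+delay d<N)) y≤u))))

    start⇐ : ∀ {k u} → handAt 0 < k → k < handAt 0 + n → k ≤ handAt (u + 0) → y k ℤ.≤ + u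
    start⇐ {u = u} lo hi k≤ with offset lo hi
    ... | d , d<N , refl = subst (ℤ._≤ + u) (+delay d<N) (+≤+
      (arrivals-galois⇐ ℓ delay delay-mono delay-positive delay-bounded d<N
        (subst (λ z → d < arrivals ℓ delay N z) (+-identityʳ u) (+-cancelʳ-< (toℕ p) _ _ k≤))))

-- Minimal periods and shifts of words.

module _ {w : Word} {p : ℕ} (period : HasPeriod w p) where

  private
    instance _ = >-nonZero (proj₁ period)

  period-* : ∀ t j → w j ≡ w (j + t * p)
  period-* zero    j = cong w (sym (+-identityʳ j))
  period-* (suc t) j = trans (proj₂ period j)
    (trans (period-* t (j + p)) (cong w (+-assoc j p (t * p))))

  -- Any `j` reduces modulo the known period `p`; hence having period `q` is a finite check.
  period-extend : ∀ q → (∀ {j} → j < p → w j ≡ w (j + q)) → ∀ j → w j ≡ w (j + q)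
  period-extend q below j = begin
    w j                        ≡⟨ cong w (m≡m%n+[m/n]*n j p) ⟩
    w (j % p + j / p * p)      ≡⟨ period-* (j / p) (j % p) ⟨
    w (j % p)                  ≡⟨ below (m%n<n j p) ⟩
    w (j % p + q)              ≡⟨ period-* (j / p) (j % p + q) ⟩
    w (j % p + q + j / p * p)  ≡⟨ cong w (+-assoc (j % p) q _) ⟩
    w (j % p + (q + j / p * p))  ≡⟨ cong (λ z → w (j % p + z)) (+-comm q _) ⟩
    w (j % p + (j / p * p + q))  ≡⟨ cong w (+-assoc (j % p) _ q) ⟨
    w (j % p + j / p * p + q)  ≡⟨ cong (λ z → w (z + q)) (m≡m%n+[m/n]*n j p) ⟨
    w (j + q)                  ∎
    where open ≡-Reasoning

  hasPeriod? : ∀ q → Dec (HasPeriod w q)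
  hasPeriod? q = 0 <? q ×-dec
    map′ (period-extend q) (λ h {j} _ → h j) (allUpTo? (λ j → w j ≟ w (j + q)) p)

  minimalPeriod : ∃ (HasMinimalPeriod w)
  minimalPeriod =
    -- The search runs over `Fin (suc p)`, so that `p` itself is a candidate.
    let q , period-q , least = ∃-best (hasPeriod? ∘ toℕ) Fin._≤_ (λ _ → ≤-refl) ≤-trans Fin.≤-total
          (fromℕ p , subst (HasPeriod w) (sym (Fin.toℕ-fromℕ p)) period)
    in toℕ q , period-q , λ m period-m → ≮⇒≥ λ m<q →
      let m<1+p = <-trans m<q (Fin.toℕ<n q)
          m≡ = Fin.toℕ-fromℕ< m<1+p
      in ≤⇒≯ (least (fromℕ< m<1+p) (subst (HasPeriod w) (sym m≡) period-m)) (subst (_< toℕ q) (sym m≡) m<q)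

module _ (w w′ : Word) {c : ℕ} (shift : ∀ j → w (c + j) ≡ w′ j) where

  HasPeriod-shift : ∀ {q} → HasPeriod w q → HasPeriod w′ q
  HasPeriod-shift {q} (0<q , period) = 0<q , λ j → begin
    w′ j             ≡⟨ shift j ⟨
    w (c + j)        ≡⟨ period (c + j) ⟩
    w (c + j + q)    ≡⟨ cong w (+-assoc c j q) ⟩
    w (c + (j + q))  ≡⟨ shift (j + q) ⟩
    w′ (j + q)       ∎
    where open ≡-Reasoning

  window-shift : ∀ p → window w c p ≡ window w′ 0 p
  window-shift p = tabulate-cong (shift ∘ toℕ)

-- Each word is a tail of the other, so they have the same periods and hence the same minimal one,
-- which may be a proper divisor of the given `p`.
Equivalent-shift : ∀ w w′ {c c′ p} → HasPeriod w p →
  (∀ j → w (c + j) ≡ w′ j) → (∀ j → w′ (c′ + j) ≡ w j) → Equivalent w w′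
Equivalent-shift w w′ {c} period shift shift′ =
  let q , period-q , least = minimalPeriod period
  in q , (period-q , least)
   , (HasPeriod-shift w w′ shift period-q , λ m → least m ∘ HasPeriod-shift w′ w shift′)
   , c , 0 , window-shift w w′ shift q

-- Counting symbols in a window.

window-suc : ∀ w a m → window w a (suc m) ≡ w a ∷ window w (suc a) m
window-suc w a m = cong₂ _∷_ (cong w (+-identityʳ a)) (tabulate-cong λ k → cong w (+-suc a (toℕ k)))

count-s+count-r : ∀ {m} (v : Vec Symbol m) → count (_≟ s) v + count (_≟ r) v ≡ m
count-s+count-r []      = refl
count-s+count-r (s ∷ v) = cong suc (count-s+count-r v)
count-s+count-r (r ∷ v) = trans (+-suc _ _) (cong suc (count-s+count-r v))

-- `gmMove` and `word` branch on the same pivot test, so one case split evaluates both sides. Adding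
-- the count of the tail `v` prepares the telescoping below.
gmSeq-step : ∀ {n m} ℓ (x : Vector ℤ n) i a (v : Vec Symbol m) → let W = word ℓ x i in
  gmSeq ℓ x a i ℤ.+ + count (_≟ r) v ≡ gmSeq ℓ x (suc a) i ℤ.+ + count (_≟ r) (W a ∷ v)
gmSeq-step ℓ x i a v with does (isPivot? ℓ (gmSeq ℓ x a) i)
... | true  = refl
... | false = lem (gmSeq ℓ x a i) (+ count (_≟ r) v)
  where lem : ∀ b c → b ℤ.+ c ≡ (b - 1ℤ) ℤ.+ (1ℤ ℤ.+ c)
        lem = solve-∀

gmSeq-count-r : ∀ {n} ℓ (x : Vector ℤ n) i a m →
  gmSeq ℓ x a i ≡ gmSeq ℓ x (a + m) i ℤ.+ + count (_≟ r) (window (word ℓ x i) a m)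
gmSeq-count-r ℓ x i a zero = trans (cong (λ z → gmSeq ℓ x z i) (sym (+-identityʳ a))) (sym (ℤ.+-identityʳ _))
gmSeq-count-r ℓ x i a (suc m) = ℤ+-cancelʳ (+ count (_≟ r) v) (begin
  gmSeq ℓ x a i ℤ.+ + count (_≟ r) v
    ≡⟨ gmSeq-step ℓ x i a v ⟩
  gmSeq ℓ x (suc a) i ℤ.+ + count (_≟ r) (W a ∷ v)
    ≡⟨ cong₂ (λ b c → b ℤ.+ + count (_≟ r) c) (gmSeq-count-r ℓ x i (suc a) m) (sym (window-suc W a m)) ⟩
  (gmSeq ℓ x (suc a + m) i ℤ.+ + count (_≟ r) v) ℤ.+ + count (_≟ r) (window W a (suc m))
    ≡⟨ cong (λ z → (gmSeq ℓ x z i ℤ.+ + count (_≟ r) v) ℤ.+ + count (_≟ r) (window W a (suc m))) (+-suc a m) ⟨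
  (gmSeq ℓ x (a + suc m) i ℤ.+ + count (_≟ r) v) ℤ.+ + count (_≟ r) (window W a (suc m))
    ≡⟨ lem (gmSeq ℓ x (a + suc m) i) (+ count (_≟ r) v) (+ count (_≟ r) (window W a (suc m))) ⟩
  (gmSeq ℓ x (a + suc m) i ℤ.+ + count (_≟ r) (window W a (suc m))) ℤ.+ + count (_≟ r) v ∎)
  where
  open ≡-Reasoning
  W = word ℓ x i
  v = window W (suc a) m
  lem : ∀ a b c → (a ℤ.+ b) ℤ.+ c ≡ (a ℤ.+ c) ℤ.+ b
  lem = solve-∀
  ℤ+-cancelʳ : ∀ {a b} c → a ℤ.+ c ≡ b ℤ.+ c → a ≡ b
  ℤ+-cancelʳ {a} {b} c eq = trans (undo a c) (trans (cong (_- c) eq) (sym (undo b c)))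
    where undo : ∀ a c → a ≡ (a ℤ.+ c) - c
          undo = solve-∀

-- Periodicity, equivalence and the drop over a period.

-- Turns the Galois connection, which speaks of natural bounds only, into inequalities between
-- unrolled values.
≤-by-ℕ : ∀ {i k} → 0ℤ ℤ.≤ i → (∀ u → i ℤ.≤ + u → k ℤ.≤ + u) → k ℤ.≤ i
≤-by-ℕ (+≤+ {n = u} _) h = h u ℤ.≤-refl

module Words {N ℓ : ℕ} {β : ℤ} (0<ℓ : 0 < ℓ) (ℓ∣β : + ℓ ℤ∣.∣ β) {I : ℕ → ℕ} (hand : IsHand ℓ N I)
  {x : Vector ℤ (suc N)} (aligned : Dynamics.Aligned 0<ℓ ℓ∣β hand 0 x) where

  open IsHand hand
  open Dynamics 0<ℓ ℓ∣β hand
  open Aligned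

  private
    n = suc N
    X = gmSeq ℓ x
    W = word ℓ x

  aligned-at : ∀ j → Aligned j (X j)
  aligned-at = Aligned-gmSeq aligned

  turns : ∀ t j → I (t * ℓ + j) ≡ t * N + I j
  turns zero    j = refl
  turns (suc t) j = begin
    I (ℓ + t * ℓ + j)    ≡⟨ cong I (+-assoc ℓ _ j) ⟩
    I (ℓ + (t * ℓ + j))  ≡⟨ turn _ ⟩
    N + I (t * ℓ + j)    ≡⟨ cong (λ z → N + z) (turns t j) ⟩
    N + (t * N + I j)    ≡⟨ +-assoc N _ _ ⟨
    N + t * N + I j      ∎
    where open ≡-Reasoning

  -- The advance is a multiple of `n`, so the pivot index recurs after `n * ℓ` moves.
  full-turns : ∀ j → I (j + n * ℓ) ≡ I j + N * n
  full-turns j = begin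
    I (j + n * ℓ)  ≡⟨ cong I (+-comm j _) ⟩
    I (n * ℓ + j)  ≡⟨ turns n j ⟩
    n * N + I j    ≡⟨ +-comm (n * N) _ ⟩
    I j + n * N    ≡⟨ cong (λ z → I j + z) (*-comm n N) ⟩
    I j + N * n    ∎
    where open ≡-Reasoning

  word-s : ∀ i j → I j % n ≡ toℕ i → W i j ≡ s
  word-s i j eq = if-yes (isPivot? ℓ (X j) i)
    (subst (IsPivot ℓ (X j)) (Fin.toℕ-injective (trans (toℕ-mod (I j)) eq)) (isPivot (aligned-at j)))

  word-r : ∀ i j → I j % n ≢ toℕ i → W i j ≡ r
  word-r i j neq = if-no (isPivot? ℓ (X j) i) λ piv → neq
    (trans (sym (toℕ-mod (I j))) (cong toℕ (IsPivot-unique {ℓ = ℓ} {X j} (isPivot (aligned-at j)) piv)))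

  word-s⁻¹ : ∀ i j → W i j ≡ s → I j % n ≡ toℕ i
  word-s⁻¹ i j eq with I j % n ≟ℕ toℕ i
  ... | yes e = e
  ... | no ne = contradiction (trans (sym (word-r i j ne)) eq) λ ()

  word-cong : ∀ i j i′ j′ → (I j % n ≡ toℕ i → I j′ % n ≡ toℕ i′) →
    (I j′ % n ≡ toℕ i′ → I j % n ≡ toℕ i) → W i j ≡ W i′ j′
  word-cong i j i′ j′ f g with I j % n ≟ℕ toℕ i
  ... | yes e = trans (word-s i j e) (sym (word-s i′ j′ (f e)))
  ... | no ne = trans (word-r i j ne) (sym (word-r i′ j′ (ne ∘ g)))

  word-period : ∀ i → HasPeriod (W i) (n * ℓ)
  word-period i = *-mono-≤ (s≤s (z≤n {N})) 0<ℓ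
    , λ j → word-cong i j i (j + n * ℓ) (trans (same j)) (trans (sym (same j)))
    where
    same : ∀ j → I (j + n * ℓ) % n ≡ I j % n
    same j = trans (cong (_% n) (full-turns j)) ([m+kn]%n≡m%n (I j) N n)

  -- A natural number congruent to `i′ - i` modulo `n`. Each turn moves the hand by -1 modulo `n`,
  -- so this many turns take it from `i′` to `i`.
  lag : Fin n → Fin n → ℕ
  lag i i′ = toℕ i′ + (n ∸ toℕ i)

  word-shift : ∀ i i′ j → W i (lag i i′ * ℓ + j) ≡ W i′ j
  word-shift i i′ j = word-cong i (t * ℓ + j) i′ j
    (forward ∘ trans (cong (_% n) (sym (turns t j))))
    (trans (cong (_% n) (turns t j)) ∘ backward)
    where
    open ≡-Reasoning
    t = lag i i′

    t+i%n : (t + toℕ i) % n ≡ toℕ i′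
    t+i%n = begin
      (t + toℕ i) % n                      ≡⟨ cong (_% n) (+-assoc (toℕ i′) _ (toℕ i)) ⟩
      (toℕ i′ + (n ∸ toℕ i + toℕ i)) % n   ≡⟨ cong (λ z → (toℕ i′ + z) % n) (m∸n+n≡m (<⇒≤ (Fin.toℕ<n i))) ⟩
      (toℕ i′ + n) % n                     ≡⟨ [m+n]%n≡m%n (toℕ i′) n ⟩
      toℕ i′ % n                           ≡⟨ m<n⇒m%n≡m (Fin.toℕ<n i′) ⟩
      toℕ i′                               ∎

    t*N+[t+b]≡b+t*n : ∀ b → t * N + (t + b) ≡ b + t * n
    t*N+[t+b]≡b+t*n b = begin
      t * N + (t + b)  ≡⟨ +-assoc (t * N) t b ⟨
      t * N + t + b    ≡⟨ cong (_+ b) (+-comm (t * N) t) ⟩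
      t + t * N + b    ≡⟨ cong (_+ b) (*-suc t N) ⟨
      t * n + b        ≡⟨ +-comm (t * n) b ⟩
      b + t * n        ∎

    -- Since `t * N + t` is a multiple of `n`, adding `t` undoes the `t` turns, and in `backward`
    -- adding `t * N` undoes the `t`.
    forward : (t * N + I j) % n ≡ toℕ i → I j % n ≡ toℕ i′
    forward eq = begin
      I j % n                    ≡⟨ [m+kn]%n≡m%n (I j) t n ⟨
      (I j + t * n) % n          ≡⟨ cong (_% n) (t*N+[t+b]≡b+t*n (I j)) ⟨
      (t * N + (t + I j)) % n    ≡⟨ cong (_% n) (x∙yz≈y∙xz +-commutativeSemigroup (t * N) t (I j)) ⟩
      (t + (t * N + I j)) % n    ≡⟨ +-%-congˡ t {t * N + I j} {toℕ i} (trans eq (sym (m<n⇒m%n≡m (Fin.toℕ<n i)))) ⟩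
      (t + toℕ i) % n            ≡⟨ t+i%n ⟩
      toℕ i′                     ∎

    backward : I j % n ≡ toℕ i′ → (t * N + I j) % n ≡ toℕ i
    backward eq = begin
      (t * N + I j) % n          ≡⟨ +-%-congˡ (t * N) {I j} {t + toℕ i} (trans eq (sym t+i%n)) ⟩
      (t * N + (t + toℕ i)) % n  ≡⟨ cong (_% n) (t*N+[t+b]≡b+t*n (toℕ i)) ⟩
      (toℕ i + t * n) % n        ≡⟨ [i+q*n]%n≡i i t ⟩
      toℕ i                      ∎

  -- By the Galois connection, `I` determines the values ahead of the hand, and `n` turns merely
  -- translate `I` by `N * n`.
  unroll-full-turns : ∀ j {k} → I j ≤ k → k < I j + n →
    unroll ℓ β (X j) k ≡ unroll ℓ β (X (j + n * ℓ)) (k + N * n)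
  unroll-full-turns j {k} lo hi with m≤n⇒m<n∨m≡n lo
  ... | inj₂ refl = trans (at-hand (aligned-at j)) (sym (trans
          (cong (unroll ℓ β (X J)) (sym (full-turns j))) (at-hand (aligned-at J))))
    where J = j + n * ℓ
  ... | inj₁ lo = ℤ.≤-antisym
          (≤-by-ℕ (ℤ.<⇒≤ (proj₁ (ahead (aligned-at J) _ lo′ hi′))) λ u h →
            galois⇐ (aligned-at j) lo hi (+-cancelʳ-≤ (N * n) _ _
              (subst (k + N * n ≤_) (I-shift u) (galois⇒ (aligned-at J) lo′ hi′ h))))
          (≤-by-ℕ (ℤ.<⇒≤ (proj₁ (ahead (aligned-at j) _ lo hi))) λ u h →
            galois⇐ (aligned-at J) lo′ hi′ (subst (k + N * n ≤_) (sym (I-shift u))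
              (+-monoˡ-≤ (N * n) (galois⇒ (aligned-at j) lo hi h))))
    where
    J = j + n * ℓ

    I-shift : ∀ u → I (u + J) ≡ I (u + j) + N * n
    I-shift u = trans (cong I (sym (+-assoc u j _))) (full-turns (u + j))

    lo′ : I J < k + N * n
    lo′ = subst (_< k + N * n) (sym (full-turns j)) (+-monoˡ-< (N * n) lo)

    hi′ : k + N * n < I J + n
    hi′ = subst (k + N * n <_) (trans (+-assoc (I j) n (N * n))
            (trans (cong (λ z → I j + z) (+-comm n (N * n))) (trans (sym (+-assoc (I j) (N * n) n)) (cong (_+ n) (sym (full-turns j))))))
            (+-monoˡ-< (N * n) hi)

  -- `k` and `k + N * n` stand for the same entry, `N` laps apart. Their unrolled values agree, so
  -- the entry itself has lost the `N * ℓ` that those laps add.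
  drop-full-turns : ∀ i j → X j i - X (j + n * ℓ) i ≡ + (N * ℓ)
  drop-full-turns i j with representative (I j) i
  ... | k , lo , hi , k≡i , _ = begin
    X j i - X J i
      ≡⟨ cong₂ _-_ (unroll-decompose ℓ β (X j) {k = k} k≡i refl)
                   (unroll-decompose ℓ β (X J) {k = k + N * n} (trans (mod-cong (k + N * n) k ([m+kn]%n≡m%n k N n)) k≡i) [k+Nn]/n) ⟩
    (unroll ℓ β (X j) k ℤ.+ (β - + (k / n * ℓ))) - (unroll ℓ β (X J) (k + N * n) ℤ.+ (β - + ((k / n + N) * ℓ)))
      ≡⟨ cong₂ (λ e q → (unroll ℓ β (X j) k ℤ.+ (β - + (k / n * ℓ))) - (e ℤ.+ (β - + q)))
           (sym (unroll-full-turns j lo hi)) (*-distribʳ-+ ℓ (k / n) N) ⟩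
    (unroll ℓ β (X j) k ℤ.+ (β - + (k / n * ℓ))) - (unroll ℓ β (X j) k ℤ.+ (β - (+ (k / n * ℓ) ℤ.+ + (N * ℓ))))
      ≡⟨ lem (unroll ℓ β (X j) k) β (+ (k / n * ℓ)) (+ (N * ℓ)) ⟩
    + (N * ℓ) ∎
    where
    open ≡-Reasoning
    J = j + n * ℓ

    [k+Nn]/n : (k + N * n) / n ≡ k / n + N
    [k+Nn]/n = trans (+-distrib-/-∣ʳ k (n∣m*n N)) (cong (λ z → k / n + z) (m*n/n≡m N n))

    lem : ∀ e b c d → (e ℤ.+ (b - c)) - (e ℤ.+ (b - (c ℤ.+ d))) ≡ d
    lem = solve-∀

  period-count-r : ∀ i a → count (_≟ r) (window (W i) a (n * ℓ)) ≡ N * ℓ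
  period-count-r i a = ℤ.+-injective (begin
    + c                                  ≡⟨ lem (X (a + n * ℓ) i) (+ c) ⟩
    (X (a + n * ℓ) i ℤ.+ + c) - X (a + n * ℓ) i  ≡⟨ cong (_- X (a + n * ℓ) i) (gmSeq-count-r ℓ x i a (n * ℓ)) ⟨
    X a i - X (a + n * ℓ) i              ≡⟨ drop-full-turns i a ⟩
    + (N * ℓ)                            ∎)
    where
    open ≡-Reasoning
    c = count (_≟ r) (window (W i) a (n * ℓ))
    lem : ∀ a c → c ≡ (a ℤ.+ c) - a
    lem = solve-∀

  period-count-s : ∀ i a → count (_≟ s) (window (W i) a (n * ℓ)) ≡ ℓ
  period-count-s i a = +-cancelʳ-≡ (N * ℓ) _ _ (trans
    (cong (λ z → count (_≟ s) (window (W i) a (n * ℓ)) + z) (sym (period-count-r i a)))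
    (count-s+count-r (window (W i) a (n * ℓ))))

  -- Lengths of maximal runs.

  ≢r⇒≡s : ∀ {c} → c ≢ r → c ≡ s
  ≢r⇒≡s {s} _   = refl
  ≢r⇒≡s {r} c≢r = contradiction refl c≢r

  -- If the hand leaves index i with a jump of D, then each of the next D - 1
  -- passes over i happens within the same jump, which starts one index further
  -- back every lap; after D laps that jump ends exactly at i.
  module _ (a : ℕ) where

    private instance _ = >-nonZero 0<ℓ

    jump : ℕ
    jump = I (suc a) ∸ I a

    I+jump : I a + jump ≡ I (suc a)
    I+jump = m+[n∸m]≡n (mono (n≤1+n a))

    regrip : I (suc a + jump * ℓ) % n ≡ I a % n
    regrip = begin
      I (suc a + jump * ℓ) % n         ≡⟨ cong (λ z → I z % n) (+-comm (suc a) _) ⟩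
      I (jump * ℓ + suc a) % n         ≡⟨ cong (_% n) (turns jump (suc a)) ⟩
      (jump * N + I (suc a)) % n       ≡⟨ cong (λ z → (jump * N + z) % n) I+jump ⟨
      (jump * N + (I a + jump)) % n    ≡⟨ cong (_% n) (x∙yz≈y∙zx +-commutativeSemigroup (jump * N) (I a) jump) ⟩
      (I a + (jump + jump * N)) % n    ≡⟨ cong (λ z → (I a + z) % n) (*-suc jump N) ⟨
      (I a + jump * n) % n             ≡⟨ [m+kn]%n≡m%n (I a) jump n ⟩
      I a % n                          ∎
      where open ≡-Reasoning

    -- After `t` complete turns the hand is strictly between `I a + t * n` and `I a + t * n + n`,
    -- which are consecutive indices congruent to `I a`.
    skip : ∀ {k} → k < jump * ℓ → I (suc a + k) % n ≢ I a % n
    skip {k} k<jump*ℓ eq = <⇒≢ above (sym (%-injective-window (<⇒≤ above) below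
      (trans eq (sym ([m+kn]%n≡m%n (I a) t n)))))
      where
      open ≤-Reasoning
      t = k / ℓ

      above : I a + t * n < I (suc a + k)
      above = begin-strict
        I a + t * n            ≡⟨ cong (λ z → I a + z) (*-suc t N) ⟩
        I a + (t + t * N)      <⟨ +-monoʳ-< (I a) (+-monoˡ-< (t * N) (m<n*o⇒m/o<n k<jump*ℓ)) ⟩
        I a + (jump + t * N)   ≡⟨ +-assoc (I a) jump _ ⟨
        I a + jump + t * N     ≡⟨ cong (_+ t * N) I+jump ⟩
        I (suc a) + t * N      ≡⟨ +-comm _ (t * N) ⟩
        t * N + I (suc a)      ≡⟨ turns t (suc a) ⟨
        I (t * ℓ + suc a)      ≤⟨ mono (+-monoˡ-≤ (suc a) (m/n*n≤m k ℓ)) ⟩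
        I (k + suc a)          ≡⟨ cong I (+-comm k (suc a)) ⟩
        I (suc a + k)          ∎

      within : suc a + k ≤ suc t * ℓ + a
      within = begin
        suc a + k                ≡⟨ +-comm (suc a) k ⟩
        k + suc a                ≡⟨ +-suc k a ⟩
        suc k + a                ≡⟨ cong (λ z → suc z + a) (m≡m%n+[m/n]*n k ℓ) ⟩
        suc (k % ℓ) + t * ℓ + a  ≤⟨ +-monoˡ-≤ a (+-monoˡ-≤ (t * ℓ) (m%n<n k ℓ)) ⟩
        suc t * ℓ + a            ∎

      below : I (suc a + k) < I a + t * n + n
      below = begin-strict
        I (suc a + k)          ≤⟨ mono within ⟩
        I (suc t * ℓ + a)      ≡⟨ turns (suc t) a ⟩
        N + t * N + I a        <⟨ +-monoˡ-< (I a) (+-mono-<-≤ (n<1+n N) (*-monoʳ-≤ t (n≤1+n N))) ⟩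
        n + t * n + I a        ≡⟨ +-comm _ (I a) ⟩
        I a + (n + t * n)      ≡⟨ cong (λ z → I a + z) (+-comm n _) ⟩
        I a + (t * n + n)      ≡⟨ +-assoc (I a) _ n ⟨
        I a + t * n + n        ∎

  -- Maximality on the left puts an `s` at `a`, so the run length is exactly `jump a * ℓ`: `skip`
  -- rules out an earlier end, `regrip` a later one.
  r-run : ∀ i a m → MaximalRun r (W i) (suc a) m → ℓ ∣ m
  r-run i a m run with <-cmp m (jump a * ℓ)
  ... | tri≈ _ refl _ = n∣m*n (jump a)
  ... | tri< m<Dℓ _ _ = contradiction
    (word-r i (suc a + m) (skip a m<Dℓ ∘ λ eq → trans eq (sym (word-s⁻¹ i a (≢r⇒≡s (left a refl)))))) right
    where open MaximalRun run
  ... | tri> _ _ Dℓ<m = contradiction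
    (trans (sym (constant _ Dℓ<m)) (word-s i (suc a + jump a * ℓ)
      (trans (regrip a) (word-s⁻¹ i a (≢r⇒≡s (left a refl)))))) λ ()
    where open MaximalRun run

  -- A longer run has `s` at both `a` and `a + ℓ`, where the hand indices differ by `N < n`; so
  -- `N = 0`. With a single entry the word is constantly `s`, and no run of it ends.
  s-run : ∀ i a m → MaximalRun s (W i) a m → m ≤ ℓ
  s-run i a m run = ≮⇒≥ λ ℓ<m →
    let I[a]%n≡i   = word-s⁻¹ i a (trans (cong (W i) (sym (+-identityʳ a))) (constant 0 nonempty))
        I[a+ℓ]%n≡i = word-s⁻¹ i (a + ℓ) (constant ℓ ℓ<m)
        I[a+ℓ]≡    = trans (cong I (+-comm a ℓ)) (turn a)
        N≡0        = +-cancelʳ-≡ (I a) N 0 (%-injective-window (m≤n+m (I a) N)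
          (subst (N + I a <_) (+-comm n (I a)) (n<1+n (N + I a)))
          (trans (cong (_% n) (sym I[a+ℓ]≡)) (trans I[a+ℓ]%n≡i (sym I[a]%n≡i))))
    in right (all-s N≡0 (a + m))
    where
    open MaximalRun run
    all-s : N ≡ 0 → ∀ j → W i j ≡ s
    all-s refl j = word-s i j (trans (n%1≡0 (I j)) (sym (n<1⇒n≡0 (Fin.toℕ<n i))))

theorem1 : (n ℓ : ℕ) .{{_ : NonZero n}} → 2 ≤ ℓ →
  (x⁰ : Vector ℤ n) → Sorted x⁰ → HasMultiple ℓ x⁰ →
  range x⁰ ℤ.≤ + ℓ →
  let x = gmSeq ℓ x⁰
      W = word ℓ x⁰
  in
  (∀ (i : Fin n) (j : ℕ) → x j i - x (j + n * ℓ) i ≡ + ((n ∸ 1) * ℓ))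
  × ((∀ i → Periodic (W i))
     × (∀ i i′ → Equivalent (W i) (W i′))
     × (∀ i → HasPeriod (W i) (n * ℓ))
     × (∃ λ (P : Vec Symbol (n * ℓ)) →
         (∀ i → ∃ λ a → window (W i) a (n * ℓ) ≡ P)
         × count (_≟ s) P ≡ ℓ
         × count (_≟ r) P ≡ (n ∸ 1) * ℓ))
  × (∀ i a m → MaximalRun r (W i) (suc a) m → ℓ ∣ m)
  × (∀ i a m → MaximalRun s (W i) a m → m ≤ ℓ)
theorem1 zero ℓ _ _ _ (() , _) _
theorem1 (suc N) ℓ 2≤ℓ x⁰ sorted multiple narrow =
    drop-full-turns
  , ( (λ i → n * ℓ , word-period i)
    , (λ i i′ → Equivalent-shift (W i) (W i′) {lag i i′ * ℓ} {lag i′ i * ℓ} (word-period i) (word-shift i i′) (word-shift i′ i))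
    , word-period
    -- The common period is read from the first word at 0; every `W i` shows it after the lag from
    -- `i` to `zero`.
    , window (W zero) 0 (n * ℓ)
    , (λ i → lag i zero * ℓ , window-shift (W i) (W zero) {lag i zero * ℓ} (word-shift i zero) (n * ℓ))
    , period-count-s zero 0
    , period-count-r zero 0)
  , r-run
  , s-run
  where
  n = suc N
  W = word ℓ x⁰
  0<ℓ = <⇒≤ 2≤ℓ
  open Start 0<ℓ sorted narrow (proj₂ (pivot-exists multiple))
  open Words 0<ℓ ℓ∣β isHand aligned-start
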